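{- 1. Modus ponens is independent of the axioms of preconditionals plus weak monotonicity: there exist a bounded lattice $L$ and a preconditional $\to$ on $L$ satisfying weak monotonicity but not modus ponens. 2. Weak monotonicity is independent of the axioms of preconditionals plus modus ponens: there exist a bounded lattice $L$ and a preconditional $\to$ on $L$ satisfying modus ponens but not weak monotonicity.
   Context: A preconditional on a bounded lattice $L$ is a binary operation $\to$ on $L$ such that for all $a,b,c\in L$: (1) $1\to a\leq a$; (2) $a\wedge b\leq a\to b$; (3) $a\to b\leq a\to(a\wedge b)$; (4) $a\to(b\wedge c)\leq a\to b$; (5) $a\to((a\wedge b)\to c)\leq (a\wedge b)\to c$. Modus ponens: $a\wedge(a\to b)\leq b$ for all $a,b\in L$. Weak monotonicity: $b\leq a\to b$ for all $a,b\in L$. -}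

module Defs where

open import Level using (Level; _⊔_)
open import Algebra.Core using (Op₂)
open import Algebra.Definitions using (Congruent₂)
open import Relation.Binary.Lattice.Bundles using (BoundedLattice)

module _ {c ℓ₁ ℓ₂ : Level} (L : BoundedLattice c ℓ₁ ℓ₂) where

  open BoundedLattice L

  -- The library's lattices carry a setoid equality _≈_, so a binary operation
  -- on the lattice must in addition respect _≈_; this is the field cong.
  record IsPreconditional (_⇒_ : Op₂ Carrier) : Set (c ⊔ ℓ₁ ⊔ ℓ₂) where
    field
      cong   : Congruent₂ _≈_ _⇒_
      axiom₁ : ∀ a → (⊤ ⇒ a) ≤ a
      axiom₂ : ∀ a b → (a ∧ b) ≤ (a ⇒ b)
      axiom₃ : ∀ a b → (a ⇒ b) ≤ (a ⇒ (a ∧ b))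
      axiom₄ : ∀ a b c → (a ⇒ (b ∧ c)) ≤ (a ⇒ b)
      axiom₅ : ∀ a b c → (a ⇒ ((a ∧ b) ⇒ c)) ≤ ((a ∧ b) ⇒ c)

  ModusPonens : Op₂ Carrier → Set (c ⊔ ℓ₂)
  ModusPonens _⇒_ = ∀ a b → (a ∧ (a ⇒ b)) ≤ b

  WeakMonotonicity : Op₂ Carrier → Set (c ⊔ ℓ₂)
  WeakMonotonicity _⇒_ = ∀ a b → b ≤ (a ⇒ b)

{-# OPTIONS --safe #-}
-- In any bounded lattice, a ∧ b is a preconditional with modus ponens, and it
-- is not weakly monotone unless the lattice is trivial, since ⊥ ∧ ⊤ ≈ ⊥.
-- If being ⊤ is decidable, the operation that sends (a , b) to b when a ≈ ⊤ and
-- to ⊤ otherwise is a weakly monotone preconditional; it violates modus ponens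
-- at (a , ⊥) for every a strictly between ⊥ and ⊤.
module Submission where

open import Defs
open import Level using (Level; 0ℓ)
open import Algebra.Core using (Op₂)
open import Data.Bool.Base using (if_then_else_)
open import Data.Fin.Subset using (Subset; inside; outside; _⊆_; _∪_; _∩_)
  renaming (⊤ to full; ⊥ to empty)
open import Data.Fin.Subset.Properties
  using (∉⊥; ⊆-isPartialOrder; ⊆-max; ⊆-min; p⊆p∪q; q⊆p∪q; x∈p∪q⁻; p∩q⊆p; p∩q⊆q; x∈p∩q⁺)
open import Data.Bool.Properties using () renaming (_≟_ to _≟ᵇ_)
open import Data.Product using (_×_; _,_; Σ-syntax)
open import Data.Sum.Base using ([_,_]′)
open import Data.Vec.Base using ([]; _∷_; here)
open import Data.Vec.Properties using (≡-dec)
open import Relation.Binary.Lattice.Bundles using (BoundedLattice)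
open import Relation.Binary.PropositionalEquality using (_≡_)
open import Relation.Nullary using (¬_; does; yes; no; contradiction)
open import Relation.Unary using (Decidable)
import Relation.Binary.Lattice.Properties.MeetSemilattice as MeetSemilatticeProperties

-- Powersets supply both examples: `n = 1` gives the two-element chain, and `n = 2` is the smallest
-- case with an element strictly between `⊥` and `⊤`.
subsetLattice : ∀ n → BoundedLattice 0ℓ 0ℓ 0ℓ
subsetLattice n = record
  { Carrier          = Subset n
  ; _≈_              = _≡_
  ; _≤_              = _⊆_
  ; _∨_              = _∪_
  ; _∧_              = _∩_
  ; ⊤                = full
  ; ⊥                = empty
  ; isBoundedLattice = record
    { isLattice = record
      { isPartialOrder = ⊆-isPartialOrder n
      ; supremum       = λ p q → p⊆p∪q q , q⊆p∪q p q ,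
                           λ _ p⊆r q⊆r x∈p∪q → [ p⊆r , q⊆r ]′ (x∈p∪q⁻ p q x∈p∪q)
      ; infimum        = λ p q → p∩q⊆p p q , p∩q⊆q p q ,
                           λ _ r⊆p r⊆q x∈r → x∈p∩q⁺ (r⊆p x∈r , r⊆q x∈r)
      }
    ; maximum   = ⊆-max
    ; minimum   = ⊆-min
    }
  }

module _ {c ℓ₁ ℓ₂ : Level} (L : BoundedLattice c ℓ₁ ℓ₂) where

  open BoundedLattice L
  open MeetSemilatticeProperties meetSemilattice using (∧-cong)

  ∧-isPreconditional : IsPreconditional L _∧_
  ∧-isPreconditional = record
    { cong   = ∧-cong
    ; axiom₁ = λ a → x∧y≤y ⊤ a
    ; axiom₂ = λ _ _ → refl
    ; axiom₃ = λ a b → ∧-greatest (x∧y≤x a b) refl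
    ; axiom₄ = λ a b c → ∧-greatest (x∧y≤x a _) (trans (x∧y≤y a _) (x∧y≤x b c))
    ; axiom₅ = λ a b c → x∧y≤y a _
    }

  ∧-modusPonens : ModusPonens L _∧_
  ∧-modusPonens a b = trans (x∧y≤y a _) (x∧y≤y a b)

  ∧-¬weakMonotonicity : ¬ (⊤ ≤ ⊥) → ¬ WeakMonotonicity L _∧_
  ∧-¬weakMonotonicity ⊤≰⊥ wm = ⊤≰⊥ (trans (wm ⊥ ⊤) (x∧y≤x ⊥ ⊤))

  module _ (⊤? : Decidable (_≈ ⊤)) where

    ⊤-guard : Op₂ Carrier
    ⊤-guard a b = if does (⊤? a) then b else ⊤

    ⊤-guard-weakMonotonicity : WeakMonotonicity L ⊤-guard
    ⊤-guard-weakMonotonicity a b with ⊤? a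
    ... | yes _ = refl
    ... | no  _ = maximum b

    ⊤-guard-isPreconditional : IsPreconditional L ⊤-guard
    ⊤-guard-isPreconditional = record
      { cong   = guard-cong
      ; axiom₁ = guard₁
      -- Weak monotonicity alone implies this axiom, because `a ∧ b ≤ b`.
      ; axiom₂ = λ a b → trans (x∧y≤y a b) (⊤-guard-weakMonotonicity a b)
      ; axiom₃ = guard₃
      ; axiom₄ = guard₄
      ; axiom₅ = guard₅
      }
      where
      guard-cong : ∀ {a a′ b b′} → a ≈ a′ → b ≈ b′ → ⊤-guard a b ≈ ⊤-guard a′ b′
      guard-cong {a} {a′} a≈a′ b≈b′ with ⊤? a | ⊤? a′
      ... | yes _   | yes _    = b≈b′
      ... | no  _   | no  _    = Eq.refl
      -- Being `⊤` is invariant under `≈`, so the guards of `a` and `a′` cannot disagree.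
      ... | yes a≈⊤ | no  a′≉⊤ = contradiction (Eq.trans (Eq.sym a≈a′) a≈⊤) a′≉⊤
      ... | no  a≉⊤ | yes a′≈⊤ = contradiction (Eq.trans a≈a′ a′≈⊤) a≉⊤

      guard₁ : ∀ a → ⊤-guard ⊤ a ≤ a
      guard₁ a with ⊤? ⊤
      ... | yes _   = refl
      ... | no  ⊤≉⊤ = contradiction Eq.refl ⊤≉⊤

      guard₃ : ∀ a b → ⊤-guard a b ≤ ⊤-guard a (a ∧ b)
      guard₃ a b with ⊤? a
      ... | yes a≈⊤ = ∧-greatest (trans (maximum b) (reflexive (Eq.sym a≈⊤))) refl
      ... | no  _   = refl

      guard₄ : ∀ a b c → ⊤-guard a (b ∧ c) ≤ ⊤-guard a b
      guard₄ a b c with ⊤? a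
      ... | yes _ = x∧y≤x b c
      ... | no  _ = refl

      -- If `a ≈ ⊤`, the outer guard returns its second argument, which is the right-hand side.
      -- Otherwise `a ∧ b ≤ a` keeps `a ∧ b` from being `⊤` as well, and both sides are `⊤`.
      guard₅ : ∀ a b c → ⊤-guard a (⊤-guard (a ∧ b) c) ≤ ⊤-guard (a ∧ b) c
      guard₅ a b c with ⊤? a | ⊤? (a ∧ b)
      ... | yes _   | _         = refl
      ... | no  _   | no  _     = refl
      ... | no  a≉⊤ | yes a∧b≈⊤ = contradiction
        (antisym (maximum a) (trans (reflexive (Eq.sym a∧b≈⊤)) (x∧y≤x a b))) a≉⊤

    ⊤-guard-¬modusPonens : ∀ a → ¬ (a ≈ ⊤) → ¬ (a ≤ ⊥) → ¬ ModusPonens L ⊤-guard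
    -- Abstracting `mp a ⊥` together with `⊤? a` lets its type reduce: in the `no` case it becomes
    -- `a ∧ ⊤ ≤ ⊥`.
    ⊤-guard-¬modusPonens a a≉⊤ a≰⊥ mp with ⊤? a | mp a ⊥
    ... | yes a≈⊤ | _     = a≉⊤ a≈⊤
    ... | no  _   | a∧⊤≤⊥ = a≰⊥ (trans (∧-greatest refl (maximum a)) a∧⊤≤⊥)

fact2 : (Σ[ L ∈ BoundedLattice 0ℓ 0ℓ 0ℓ ] Σ[ _⇒_ ∈ Op₂ (BoundedLattice.Carrier L) ]
    (IsPreconditional L _⇒_ × WeakMonotonicity L _⇒_ × ¬ ModusPonens L _⇒_))
    ×
    (Σ[ L ∈ BoundedLattice 0ℓ 0ℓ 0ℓ ] Σ[ _⇒_ ∈ Op₂ (BoundedLattice.Carrier L) ]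
    (IsPreconditional L _⇒_ × ModusPonens L _⇒_ × ¬ WeakMonotonicity L _⇒_))
fact2 =
  ( L₂ , ⊤-guard L₂ full?
  , ⊤-guard-isPreconditional L₂ full?
  , ⊤-guard-weakMonotonicity L₂ full?
  -- The witness is the singleton of the first point: it differs from `full` in the second entry,
  -- and `here` shows that it is not contained in `empty`.
  , ⊤-guard-¬modusPonens L₂ full? (inside ∷ outside ∷ []) (λ ()) (λ p⊆∅ → ∉⊥ (p⊆∅ here))
  ) ,
  ( L₁ , _∩_
  , ∧-isPreconditional L₁
  , ∧-modusPonens L₁
  , ∧-¬weakMonotonicity L₁ (λ full⊆∅ → ∉⊥ (full⊆∅ here))
  )
  where
  L₁ = subsetLattice 1
  L₂ = subsetLattice 2

  full? : Decidable {A = Subset 2} (_≡ full)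
  full? p = ≡-dec _≟ᵇ_ p full
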